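{- Greedy-weight is an $O(\log|X|)$-approximation for $\mathrm{MFD}_{\mathbb N}$ on width-stable graphs. That is, there is an absolute constant $C>0$ such that for every width-stable graph $G=(V,E)$ and every flow $X\colon E\to\mathbb N$ with $|X|\ge 2$, the number of paths used by greedy-weight to decompose $X$ is at most $C\cdot\log|X|\cdot\mathrm{mfd}_{\mathbb N}(G,X)$.
   Context: All graphs here are $s$-$t$ DAGs: directed acyclic graphs $G=(V,E)$ with a unique source $s$ (no in-edges) and a unique sink $t$ (no out-edges). A flow is a function $X$ on $E$ such that at every node of $V\setminus\{s,t\}$ incoming flow equals outgoing flow; $|X|$ is the total flow out of $s$. An $s$-$t$ path $P$ is identified with the flow that is $1$ on the edges of $P$ and $0$ elsewhere. A flow decomposition of $(G,X)$ of size $k$ with weights in $\mathbb N$ ($0\in\mathbb N$) is a family of $s$-$t$ paths $P_1,\dots,P_k$ with weights $w_1,\dots,w_k\in\mathbb N$ such that $X=w_1P_1+\dots+w_kP_k$; $\mathrm{mfd}_{\mathbb N}(G,X)$ is the smallest size of such a decomposition, and $\mathrm{MFD}_{\mathbb N}$ is the problem of finding one of smallest size. For a non-negative flow $X$ on $G$, $G|_X$ is the spanning subgraph of $G$ consisting of the edges $e$ with $X(e)\neq 0$. $\mathrm{width}(G|_X)$ is the minimum number of $s$-$t$ paths in $G|_X$ needed to cover all edges of $G|_X$. $X\le Y$ means $X(e)\le Y(e)$ for all $e\in E$. The graph $G$ is width-stable if for any non-negative flows $X\le Y$ on $G$ it holds that $\mathrm{width}(G|_X)\le\mathrm{width}(G|_Y)$.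 A path $P$ carries flow $p$ if $X(e)\ge p$ for every edge $e$ of $P$. Greedy-weight is the algorithm that, starting from $X$, repeatedly picks a heaviest path, i.e. an $s$-$t$ path carrying the largest possible flow $p$ in the current remaining flow (ties broken arbitrarily), adds it to the decomposition with weight $p$, and subtracts $p$ from the remaining flow on each of its edges, until the remaining flow is $0$. Logarithms are base $2$. -}

module Defs where

open import Data.Fin.Base using (Fin)
open import Data.Fin.Properties using (_≟_)
open import Data.List.Base using (List; []; _∷_)
open import Data.List.Membership.Propositional using (_∈_)
open import Data.List.Membership.DecPropositional using (_∈?_)
open import Data.List.Relation.Unary.All using (All)
open import Data.Nat.Base using (ℕ; _*_; _^_; _∸_; _≤_)
open import Data.Nat.Properties using (+-0-commutativeMonoid)
open import Data.Bool.Base using (if_then_else_)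
open import Data.Product.Base using (_×_; _,_; ∃-syntax)
open import Relation.Binary.Construct.Closure.ReflexiveTransitive
  using (Star; ε; _◅_)
open import Relation.Binary.Construct.Closure.Transitive using (TransClosure)
open import Relation.Binary.PropositionalEquality.Core using (_≡_; _≢_)
open import Relation.Nullary.Decidable.Core using (does)
open import Relation.Nullary.Negation.Core using (¬_)
open import Relation.Unary using (Pred)
open import Level using (0ℓ)

open import Algebra.Properties.CommutativeMonoid.Sum +-0-commutativeMonoid public
  using (sum)

record STDAG : Set where
  field
    #V #E   : ℕ
    src tgt : Fin #E → Fin #V

  V : Set
  V = Fin #V

  E : Set
  E = Fin #E

  Arc : V → V → Set
  Arc u v = ∃[ e ] (src e ≡ u × tgt e ≡ v)

  field
    -- No parallel edges: E is a subset of V × V.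
    simple        : ∀ {e f} → src e ≡ src f → tgt e ≡ tgt f → e ≡ f
    acyclic       : ∀ v → ¬ TransClosure Arc v v
    s t           : V
    s-source      : ∀ e → tgt e ≢ s
    source-unique : ∀ v → (∀ e → tgt e ≢ v) → v ≡ s
    t-sink        : ∀ e → src e ≢ t
    sink-unique   : ∀ v → (∀ e → src e ≢ v) → v ≡ t

IsMinimum : Pred ℕ 0ℓ → Pred ℕ 0ℓ
IsMinimum P k = P k × (∀ j → P j → k ≤ j)

-- For x ≥ 1, the real inequality a ≤ c · log₂ x, exponentiated to stay in ℕ.
infix 4 _≤_·log₂_
_≤_·log₂_ : ℕ → ℕ → ℕ → Set
a ≤ c ·log₂ x = 2 ^ a ≤ x ^ c

module Flows (G : STDAG) where
  open STDAG G

  STPath : Set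
  STPath = Star Arc s t

  EdgeFun : Set
  EdgeFun = E → ℕ

  edges : ∀ {u v} → Star Arc u v → List E
  edges ε             = []
  edges ((e , _) ◅ p) = e ∷ edges p

  infix 8 ⟦_⟧
  ⟦_⟧ : STPath → EdgeFun
  ⟦ P ⟧ e = if does (_∈?_ _≟_ e (edges P)) then 1 else 0

  inflow outflow : EdgeFun → V → ℕ
  inflow  X v = sum λ e → if does (tgt e ≟ v) then X e else 0
  outflow X v = sum λ e → if does (src e ≟ v) then X e else 0

  IsFlow : Pred (EdgeFun) 0ℓ
  IsFlow X = ∀ v → v ≢ s → v ≢ t → inflow X v ≡ outflow X v

  ∣_∣ : EdgeFun → ℕ
  ∣ X ∣ = outflow X s

  infix 4 _≤ᶠ_
  _≤ᶠ_ : EdgeFun → EdgeFun → Set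
  X ≤ᶠ Y = ∀ e → X e ≤ Y e

  record Decomposition (X : EdgeFun) (k : ℕ) : Set where
    field
      path        : Fin k → STPath
      weight      : Fin k → ℕ
      decomposes  : ∀ e → X e ≡ sum λ i → weight i * ⟦ path i ⟧ e

  IsMfd : EdgeFun → Pred ℕ 0ℓ
  IsMfd X = IsMinimum (Decomposition X)

  -- A spanning subgraph of G is given by its set of edges.
  Subgraph : Set₁
  Subgraph = Pred E 0ℓ

  support : EdgeFun → Subgraph
  support X e = X e ≢ 0

  record PathCover (H : Subgraph) (k : ℕ) : Set where
    field
      path   : Fin k → STPath
      inside : ∀ i → All H (edges (path i))
      covers : ∀ e → H e → ∃[ i ] (e ∈ edges (path i))

  IsWidth : Subgraph → Pred ℕ 0ℓ
  IsWidth H = IsMinimum (PathCover H)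

  Carries : EdgeFun → STPath → ℕ → Set
  Carries X P p = All (λ e → p ≤ X e) (edges P)

  IsHeaviest : EdgeFun → STPath → ℕ → Set
  IsHeaviest X P p = Carries X P p × (∀ Q q → Carries X Q q → q ≤ p)

  -- GreedyWeight X D: some tie-breaking makes greedy-weight, started on X,
  -- stop with the list D of weighted paths. The truncated subtraction never
  -- truncates, since P carries p.
  data GreedyWeight (X : EdgeFun) : List (STPath × ℕ) → Set where
    stop : (∀ e → X e ≡ 0) → GreedyWeight X []
    pick : ∀ {P p D} → ¬ (∀ e → X e ≡ 0) → IsHeaviest X P p →
           GreedyWeight (λ e → X e ∸ p * ⟦ P ⟧ e) D →
           GreedyWeight X ((P , p) ∷ D)

  WidthStable : Set
  WidthStable =
    ∀ X Y → IsFlow X → IsFlow Y → X ≤ᶠ Y →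
    ∀ a b → IsWidth (support X) a → IsWidth (support Y) b → a ≤ b

-- Let p be the weight of a heaviest path of the remaining flow X. Let S be the
-- set of nodes reachable from s along edges of flow > p, and T the set of nodes
-- from which t is reachable in the support of X outside S. By maximality of p
-- we have t ∉ S, every edge leaving S carries at most p, and every edge of the
-- support entering T comes from S. Hence |X| ≤ p · k, where k is the number of
-- support edges from S to T. Extend each of these k edges to an s-t path
-- through S before it and outside S after it. In the union of these paths no
-- edge enters S, so every path of the union uses at most one of the k edges and
-- the union has width k. By width-stability k is at most the width of the
-- support of the original flow, which is at most m = mfd. So a greedy step takes
-- |X| from n' + p to n' with n' + p ≤ m · p, and then 2 n'^m ≤ (n' + p)^m by the
-- first two terms of the binomial expansion; thus greedy-weight makes at most
-- m · log (2|X|) ≤ 2 m · log |X| steps.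

module Submission where

open import Defs
open import Data.Nat.Base using (ℕ; _*_; _≤_; _<_)
open import Data.List.Base using (List; length)
open import Data.Product.Base using (_×_; ∃-syntax)

open import Data.Bool.Base using (Bool; true; false; not; if_then_else_)
open import Data.Fin.Base using (Fin; zero; suc)
open import Data.Fin.Properties using (_≟_; injective⇒≤; sequence)
open import Data.List.Base using ([]; _∷_; filter; tabulate; allFin; lookup)
open import Data.List.Membership.Propositional using (_∈_; _∉_)
open import Data.List.Membership.DecPropositional using (_∈?_)
open import Data.List.Membership.Propositional.Properties using (∈-lookup)
open import Data.List.Relation.Unary.All as All using (All; []; _∷_)
open import Data.List.Relation.Unary.All.Properties using (all-filter)
open import Data.List.Relation.Unary.Any using (here; there)
open import Data.List.Relation.Unary.AllPairs using (_∷_)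
open import Data.List.Relation.Unary.Unique.Propositional using (Unique)
open import Data.List.Relation.Unary.Unique.Propositional.Properties
  using (allFin⁺; filter⁺)
open import Data.Nat.Base
  using (zero; suc; _+_; _∸_; _^_; z≤n; s≤s; NonZero; >-nonZero)
import Data.Nat.Properties as ℕ
open import Data.Nat.Induction using (<-rec)
open import Data.Product.Base using (Σ; _,_; proj₁; proj₂)
open import Effect.Monad using (RawMonad)
open import Function.Base using (_∘_)
open import Function.Bundles using (mk⇔)
open import Level using (0ℓ)
open import Relation.Binary.Construct.Closure.ReflexiveTransitive
  using (Star; ε; _◅_; _◅◅_)
open import Relation.Binary.Construct.Closure.Transitive
  using (TransClosure; [_]; _∷_)
open import Relation.Binary.PropositionalEquality
  using (_≡_; _≢_; refl; sym; trans; cong; cong₂; subst; module ≡-Reasoning)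
open import Relation.Nullary.Decidable
  using (Dec; yes; no; does; ¬?; _×-dec_; does-⇔; dec-true; dec-false;
         decidable-stable; ¬¬-excluded-middle)
open import Relation.Nullary.Negation
  using (¬_; ¬¬-Monad; contradiction)
open import Relation.Unary using (Pred; _⊆_)
import Algebra.Properties.CommutativeMonoid.Sum ℕ.+-0-commutativeMonoid as Sum
import Algebra.Properties.Semiring.Sum ℕ.+-*-semiring as SemiringSum
open import Data.Nat.Solver using (module +-*-Solver)

-- Classical principles under double negation

-- Finitely many instances of excluded middle can be collected under one double negation. It
-- supplies decisions for reachability; the goals where it is used are inequalities in `ℕ`, hence
-- stable.
¬¬-dec : ∀ {n} (P : Pred (Fin n) 0ℓ) → ¬ ¬ (∀ i → Dec (P i))
¬¬-dec P = sequence (RawMonad.rawApplicative ¬¬-Monad) (λ _ → ¬¬-excluded-middle)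

¬¬-minimum : ∀ (P : Pred ℕ 0ℓ) {k} → P k → ¬ ¬ (∃[ j ] IsMinimum P j)
¬¬-minimum P {k} Pk none = <-rec (λ k → ¬ P k)
  (λ k below Pk → none (k , Pk , λ j Pj → ℕ.≮⇒≥ λ j<k → below j<k Pj)) k Pk

-- Finite sums and enumerations

sum-mono-≤ : ∀ {n} {f g : Fin n → ℕ} → (∀ i → f i ≤ g i) → sum f ≤ sum g
sum-mono-≤ {zero}  f≤g = z≤n
sum-mono-≤ {suc n} f≤g = ℕ.+-mono-≤ (f≤g zero) (sum-mono-≤ (f≤g ∘ suc))

sum-mono-< : ∀ {n} {f g : Fin n → ℕ} →
             (∀ i → f i ≤ g i) → ∀ i → f i < g i → sum f < sum g
sum-mono-< f≤g zero    f<g = ℕ.+-mono-<-≤ f<g (sum-mono-≤ (f≤g ∘ suc))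
sum-mono-< f≤g (suc i) f<g =
  ℕ.+-mono-≤-< (f≤g zero) (sum-mono-< (f≤g ∘ suc) i f<g)

sum≢0⇒∃ : ∀ {n} (f : Fin n → ℕ) → sum f ≢ 0 → ∃[ i ] f i ≢ 0
sum≢0⇒∃ {zero}  f ∑≢0 = contradiction refl ∑≢0
sum≢0⇒∃ {suc n} f ∑≢0 with f zero in f0≡
... | suc _ = zero , λ f0≡0 → ℕ.1+n≢0 (trans (sym f0≡) f0≡0)
... | zero with sum≢0⇒∃ (f ∘ suc) ∑≢0
... | i , fi≢0 = suc i , fi≢0

summand≤sum : ∀ {n} (f : Fin n → ℕ) i → f i ≤ sum f
summand≤sum f zero    = ℕ.m≤m+n _ _
summand≤sum f (suc i) = ℕ.m≤n⇒m≤o+n (f zero) (summand≤sum (f ∘ suc) i)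

sum-at : ∀ {n} (u : Fin n) (f : Fin n → ℕ) →
         sum (λ v → if does (u ≟ v) then f v else 0) ≡ f u
sum-at {suc n} zero    f =
  trans (cong (f zero +_) (Sum.sum-replicate-zero n)) (ℕ.+-identityʳ _)
sum-at {suc n} (suc u) f = sum-at u (f ∘ suc)

-- The function `f` is general so that the induction can pass to `f ∘ suc`; with the identity, the
-- list is a filtered `allFin`.
sum≤*-count : ∀ {n p} {A : Set} {P : Pred A 0ℓ} (P? : ∀ a → Dec (P a))
              (f : Fin n → A) (w : A → ℕ) → (∀ a → P a → w a ≤ p) →
              sum (λ i → if does (P? (f i)) then w (f i) else 0)
                ≤ length (filter P? (tabulate f)) * p
sum≤*-count {zero}  P? f w w≤p = z≤n
sum≤*-count {suc n} P? f w w≤p with P? (f zero)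
... | yes Pf = ℕ.+-mono-≤ (w≤p _ Pf) (sum≤*-count P? (f ∘ suc) w w≤p)
... | no  _  = sum≤*-count P? (f ∘ suc) w w≤p

unique-lookup-injective : ∀ {A : Set} {xs : List A} → Unique xs →
                          ∀ {i j} → lookup xs i ≡ lookup xs j → i ≡ j
unique-lookup-injective (x∉ ∷ u) {zero}  {zero}  eq = refl
unique-lookup-injective (x∉ ∷ u) {zero}  {suc j} eq =
  contradiction eq (All.lookup x∉ (∈-lookup j))
unique-lookup-injective (x∉ ∷ u) {suc i} {zero}  eq =
  contradiction (sym eq) (All.lookup x∉ (∈-lookup i))
unique-lookup-injective (x∉ ∷ u) {suc i} {suc j} eq =
  cong suc (unique-lookup-injective u eq)

-- Inequalities between powers

-- These are the first two terms of the binomial expansion. The induction multiplies by `a + b` and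
-- drops the term in `b * b`.
^-add : ∀ a b m → a ^ suc m + suc m * b * a ^ m ≤ (a + b) ^ suc m
^-add a b zero    = ℕ.≤-reflexive
  (solve 2 (λ a b → a :* con 1 :+ (b :+ con 0) :* con 1 := (a :+ b) :* con 1) refl a b)
  where open +-*-Solver
^-add a b (suc m) = begin
  a * (a * a ^ m) + (b + suc m * b) * (a * a ^ m)
    ≤⟨ ℕ.m≤m+n _ _ ⟩
  a * (a * a ^ m) + (b + suc m * b) * (a * a ^ m) + b * (suc m * b * a ^ m)
    ≡⟨ solve 4 (λ a b x c →
         a :* (a :* x) :+ (b :+ c) :* (a :* x) :+ b :* (c :* x)
           := (a :+ b) :* (a :* x :+ c :* x))
       refl a b (a ^ m) (suc m * b) ⟩
  (a + b) * (a * a ^ m + suc m * b * a ^ m)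
    ≤⟨ ℕ.*-monoʳ-≤ (a + b) (^-add a b m) ⟩
  (a + b) * (a + b) ^ suc m ∎
  where
  open +-*-Solver
  open ℕ.≤-Reasoning

-- Since `a ≤ m * b`, the second binomial term is at least as large as the first, `a ^ m`.
^-halving : ∀ a b m → 0 < m → a + b ≤ m * b → 2 * a ^ m ≤ (a + b) ^ m
^-halving a b (suc m) _ a+b≤mb = begin
  2 * a ^ suc m                     ≡⟨ cong (a ^ suc m +_) (ℕ.+-identityʳ _) ⟩
  a ^ suc m + a * a ^ m             ≤⟨ ℕ.+-monoʳ-≤ (a ^ suc m) (ℕ.*-monoˡ-≤ (a ^ m)
                                         (ℕ.m+n≤o⇒m≤o a a+b≤mb)) ⟩
  a ^ suc m + suc m * b * a ^ m     ≤⟨ ^-add a b m ⟩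
  (a + b) ^ suc m                   ∎
  where open ℕ.≤-Reasoning

^-distribʳ-* : ∀ m a b → (a * b) ^ m ≡ a ^ m * b ^ m
^-distribʳ-* zero    a b = refl
^-distribʳ-* (suc m) a b = trans (cong (a * b *_) (^-distribʳ-* m a b))
  (solve 4 (λ a b x y → (a :* b) :* (x :* y) := (a :* x) :* (b :* y)) refl a b (a ^ m) (b ^ m))
  where open +-*-Solver

-- Flow through sets of edges, and cuts

module _ (G : STDAG) where
  open STDAG G
  open Flows G

  -- `inflow`, `outflow` and `∣_∣` are instances by definition, so the linearity laws below serve
  -- all three.
  flux : (E → Bool) → EdgeFun → ℕ
  flux b X = sum λ e → if b e then X e else 0

  private
    if-+ : ∀ b {x y} → (if b then x + y else 0)
                       ≡ (if b then x else 0) + (if b then y else 0)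
    if-+ true  = refl
    if-+ false = refl

    if-* : ∀ b c {x} → (if b then c * x else 0) ≡ c * (if b then x else 0)
    if-* true  c = refl
    if-* false c = sym (ℕ.*-zeroʳ c)

    if-swap : ∀ b c {x : ℕ} → (if b then (if c then x else 0) else 0)
                              ≡ (if c then (if b then x else 0) else 0)
    if-swap true  _     = refl
    if-swap false true  = refl
    if-swap false false = refl

    if-sum : ∀ b {n} (f : Fin n → ℕ) →
             (if b then sum f else 0) ≡ sum (λ i → if b then f i else 0)
    if-sum true      f = refl
    if-sum false {n} f = sym (Sum.sum-replicate-zero n)

  flux-cong : ∀ b {X Y} → (∀ e → X e ≡ Y e) → flux b X ≡ flux b Y
  flux-cong b X≗Y = Sum.sum-cong-≗ λ e → cong (λ x → if b e then x else 0) (X≗Y e)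

  flux-0 : ∀ b → flux b (λ _ → 0) ≡ 0
  flux-0 b = trans (Sum.sum-cong-≗ λ e → if-0 (b e)) (Sum.sum-replicate-zero #E)
    where
    if-0 : ∀ b → (if b then 0 else 0) ≡ 0
    if-0 true  = refl
    if-0 false = refl

  flux-+ : ∀ b X Y → flux b (λ e → X e + Y e) ≡ flux b X + flux b Y
  flux-+ b X Y = trans (Sum.sum-cong-≗ λ e → if-+ (b e) {X e} {Y e})
    (Sum.∑-distrib-+ (λ e → if b e then X e else 0) (λ e → if b e then Y e else 0))

  flux-* : ∀ b c X → flux b (λ e → c * X e) ≡ c * flux b X
  flux-* b c X = trans (Sum.sum-cong-≗ λ e → if-* (b e) c {X e})
    (sym (SemiringSum.*-distribˡ-sum c (λ e → if b e then X e else 0)))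

  flux-at : ∀ b e′ → flux b (λ e → if does (e ≟ e′) then 1 else 0)
                     ≡ (if b e′ then 1 else 0)
  flux-at b e′ = trans
    (Sum.sum-cong-≗ λ e → trans
      (if-swap (b e) (does (e ≟ e′)))
      (cong (if_then _ else 0) (does-⇔ (mk⇔ sym sym) (e ≟ e′) (e′ ≟ e))))
    (sum-at e′ (λ e → if b e then 1 else 0))

  -- After exchanging the two sums, each edge `e` contributes at the single vertex `h e`. With `h`
  -- equal to `src` or `tgt` this adds up outflows or inflows over `B`.
  flux-partition : ∀ (h : E → V) (B : V → Bool) X →
    sum (λ v → if B v then flux (λ e → does (h e ≟ v)) X else 0) ≡ flux (B ∘ h) X
  flux-partition h B X = begin
    sum (λ v → if B v then flux (λ e → does (h e ≟ v)) X else 0)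
      ≡⟨ Sum.sum-cong-≗ (λ v → trans
           (if-sum (B v) (λ e → if does (h e ≟ v) then X e else 0))
           (Sum.sum-cong-≗ λ e → if-swap (B v) (does (h e ≟ v)) {X e})) ⟩
    sum (λ v → sum λ e → part v e)
      ≡⟨ Sum.∑-comm part ⟩
    sum (λ e → sum λ v → part v e)
      ≡⟨ Sum.sum-cong-≗ (λ e → sum-at (h e) (λ v → if B v then X e else 0)) ⟩
    flux (B ∘ h) X ∎
    where
    open ≡-Reasoning
    part : V → EdgeFun
    part v e = if does (h e ≟ v) then (if B v then X e else 0) else 0

  inflow-s : ∀ X → inflow X s ≡ 0
  inflow-s X = trans
    (Sum.sum-cong-≗ λ e →
      cong (if_then X e else 0) (dec-false (tgt e ≟ s) (s-source e)))
    (Sum.sum-replicate-zero #E)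

  value≢0⇒s≢t : ∀ X → ∣ X ∣ ≢ 0 → s ≢ t
  value≢0⇒s≢t X ∣X∣≢0 s≡t = ∣X∣≢0 (trans
    (Sum.sum-cong-≗ λ e → cong (if_then X e else 0)
      (dec-false (src e ≟ s) λ src≡s → t-sink e (trans src≡s s≡t)))
    (Sum.sum-replicate-zero #E))

  -- Conservation is summed over the vertices of `B`. As `t` is excluded, only `s` can be
  -- unbalanced, and its inflow is 0.
  cut : ∀ {X} → IsFlow X → (B : V → Bool) → B t ≡ false →
        flux (B ∘ src) X ≡ flux (B ∘ tgt) X + (if B s then ∣ X ∣ else 0)
  cut {X} flow B Bt = begin
    flux (B ∘ src) X
      ≡⟨ flux-partition src B X ⟨
    sum (λ v → if B v then outflow X v else 0)
      ≡⟨ Sum.sum-cong-≗ balance ⟩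
    sum (λ v → in-B v + at-s v)
      ≡⟨ Sum.∑-distrib-+ in-B at-s ⟩
    sum in-B + sum at-s
      ≡⟨ cong₂ _+_ (flux-partition tgt B X)
                   (sum-at s (λ v → if B v then outflow X v else 0)) ⟩
    flux (B ∘ tgt) X + (if B s then ∣ X ∣ else 0) ∎
    where
    open ≡-Reasoning
    in-B at-s : V → ℕ
    in-B v = if B v then inflow X v else 0
    at-s v = if does (s ≟ v) then (if B v then outflow X v else 0) else 0
    balance : ∀ v → (if B v then outflow X v else 0) ≡ in-B v + at-s v
    balance v with s ≟ v | B v in Bv
    ... | yes _    | false = refl
    ... | no  _    | false = refl
    ... | yes refl | true  = cong (_+ outflow X s) (sym (inflow-s X))
    ... | no  s≢v  | true  = trans
      (sym (flow v (s≢v ∘ sym)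
                   (λ { refl → contradiction (trans (sym Bv) Bt) λ () })))
      (sym (ℕ.+-identityʳ _))

  -- Paths as unit flows

  -- Unlike the indicator `⟦_⟧`, this count is additive along a walk, which allows induction on the
  -- walk.
  multiplicity : ∀ {u v} → Star Arc u v → EdgeFun
  multiplicity ε              e = 0
  multiplicity ((e′ , _) ◅ p) e = (if does (e ≟ e′) then 1 else 0) + multiplicity p e

  -- A walk enters `w` as often as it leaves it, once its start counts as an entry and its end as an
  -- exit.
  multiplicity-balance : ∀ {u v} (p : Star Arc u v) w →
    inflow (multiplicity p) w + (if does (u ≟ w) then 1 else 0)
      ≡ outflow (multiplicity p) w + (if does (v ≟ w) then 1 else 0)
  multiplicity-balance {u} ε w = cong (_+ (if does (u ≟ w) then 1 else 0))
    (trans (flux-0 _) (sym (flux-0 _)))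
  multiplicity-balance {v = v} ((e′ , refl , refl) ◅ p) w = begin
    inflow (multiplicity ((e′ , refl , refl) ◅ p)) w + u₁
      ≡⟨ cong (_+ u₁) (trans (flux-+ _ _ (multiplicity p))
           (cong (_+ i) (flux-at (λ e → does (tgt e ≟ w)) e′))) ⟩
    (u₂ + i) + u₁
      ≡⟨ solve 3 (λ u₂ i u₁ → (u₂ :+ i) :+ u₁ := u₁ :+ (i :+ u₂)) refl u₂ i u₁ ⟩
    u₁ + (i + u₂)
      ≡⟨ cong (u₁ +_) (multiplicity-balance p w) ⟩
    u₁ + (o + _)
      ≡⟨ ℕ.+-assoc u₁ o _ ⟨
    (u₁ + o) + _
      ≡⟨ cong (_+ (if does (v ≟ w) then 1 else 0))
           (trans (flux-+ _ _ (multiplicity p))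
             (cong (_+ o) (flux-at (λ e → does (src e ≟ w)) e′))) ⟨
    outflow (multiplicity ((e′ , refl , refl) ◅ p)) w + _ ∎
    where
    open ≡-Reasoning
    open +-*-Solver
    u₁ = if does (src e′ ≟ w) then 1 else 0
    u₂ = if does (tgt e′ ≟ w) then 1 else 0
    i  = inflow (multiplicity p) w
    o  = outflow (multiplicity p) w

  star-to-src : ∀ {u v e} (p : Star Arc u v) → e ∈ edges p → Star Arc u (src e)
  star-to-src ((e , refl , _) ◅ p) (here refl) = ε
  star-to-src (a ◅ p)              (there e∈)  = a ◅ star-to-src p e∈

  closed-walk : ∀ {u v w} → Arc u v → Star Arc v w → TransClosure Arc u w
  closed-walk a ε       = [ a ]
  closed-walk a (b ◅ p) = a ∷ closed-walk b p

  edges-simple : ∀ {e v} (p : Star Arc (tgt e) v) → e ∉ edges p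
  edges-simple {e} p e∈ = acyclic (src e) (closed-walk (e , refl , refl) (star-to-src p e∈))

  multiplicity-∉ : ∀ {u v e} (p : Star Arc u v) → e ∉ edges p → multiplicity p e ≡ 0
  multiplicity-∉         ε              e∉ = refl
  multiplicity-∉ {e = e} ((e′ , _) ◅ p) e∉ with e ≟ e′
  ... | yes e≡e′ = contradiction (here e≡e′) e∉
  ... | no  _    = multiplicity-∉ p (e∉ ∘ there)

  -- By acyclicity no walk repeats an edge, so the count never exceeds 1.
  indicator≡multiplicity : ∀ {u v} (p : Star Arc u v) e →
    (if does (_∈?_ _≟_ e (edges p)) then 1 else 0) ≡ multiplicity p e
  indicator≡multiplicity ε e = refl
  indicator≡multiplicity ((e′ , refl , refl) ◅ p) e with e ≟ e′
  ... | yes refl = cong suc (sym (multiplicity-∉ p (edges-simple p)))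
  ... | no  _    = indicator≡multiplicity p e

  path-flow : ∀ P → IsFlow ⟦ P ⟧
  path-flow P v v≢s v≢t = begin
    inflow ⟦ P ⟧ v  ≡⟨ flux-cong _ (indicator≡multiplicity P) ⟩
    i               ≡⟨ ℕ.+-identityʳ i ⟨
    i + 0           ≡⟨ cong (λ b → i + (if b then 1 else 0))
                         (dec-false (s ≟ v) (v≢s ∘ sym)) ⟨
    i + _           ≡⟨ multiplicity-balance P v ⟩
    o + _           ≡⟨ cong (λ b → o + (if b then 1 else 0))
                         (dec-false (t ≟ v) (v≢t ∘ sym)) ⟩
    o + 0           ≡⟨ ℕ.+-identityʳ o ⟩
    o               ≡⟨ flux-cong _ (indicator≡multiplicity P) ⟨
    outflow ⟦ P ⟧ v ∎
    where
    open ≡-Reasoning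
    i = inflow (multiplicity P) v
    o = outflow (multiplicity P) v

  -- If `s ≡ t`, the only path is empty and has value 0, hence the hypothesis.
  ∣path∣ : s ≢ t → ∀ P → ∣ ⟦ P ⟧ ∣ ≡ 1
  ∣path∣ s≢t P = begin
    outflow ⟦ P ⟧ s  ≡⟨ flux-cong _ (indicator≡multiplicity P) ⟩
    o                ≡⟨ ℕ.+-identityʳ o ⟨
    o + 0            ≡⟨ cong (λ b → o + (if b then 1 else 0))
                          (dec-false (t ≟ s) (s≢t ∘ sym)) ⟨
    o + _            ≡⟨ multiplicity-balance P s ⟨
    inflow (multiplicity P) s + _
                     ≡⟨ cong₂ _+_ (inflow-s (multiplicity P))
                          (cong (if_then 1 else 0) (dec-true (s ≟ s) refl)) ⟩
    1                ∎
    where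
    open ≡-Reasoning
    o = outflow (multiplicity P) s

  path≤1 : ∀ P e → ⟦ P ⟧ e ≤ 1
  path≤1 P e with does (_∈?_ _≟_ e (edges P))
  ... | true  = ℕ.≤-refl
  ... | false = z≤n

  path-∈ : ∀ P {e} → e ∈ edges P → ⟦ P ⟧ e ≡ 1
  path-∈ P {e} e∈ = cong (if_then 1 else 0) (dec-true (_∈?_ _≟_ e (edges P)) e∈)

  path≢0 : ∀ P {e} → ⟦ P ⟧ e ≢ 0 → e ∈ edges P
  path≢0 P {e} ≢0 with _∈?_ _≟_ e (edges P)
  ... | yes e∈ = e∈
  ... | no  _  = contradiction refl ≢0

  -- Closure properties of flows

  IsFlow-0 : IsFlow (λ _ → 0)
  IsFlow-0 v _ _ = trans (flux-0 _) (sym (flux-0 _))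

  IsFlow-+ : ∀ {X Y} → IsFlow X → IsFlow Y → IsFlow (λ e → X e + Y e)
  IsFlow-+ {X} {Y} fX fY v v≢s v≢t =
    trans (flux-+ _ X Y) (trans (cong₂ _+_ (fX v v≢s v≢t) (fY v v≢s v≢t))
                                (sym (flux-+ _ X Y)))

  IsFlow-* : ∀ c {X} → IsFlow X → IsFlow (λ e → c * X e)
  IsFlow-* c {X} fX v v≢s v≢t =
    trans (flux-* _ c X) (trans (cong (c *_) (fX v v≢s v≢t)) (sym (flux-* _ c X)))

  IsFlow-sum : ∀ {k} (X : Fin k → EdgeFun) → (∀ i → IsFlow (X i)) →
               IsFlow (λ e → sum λ i → X i e)
  IsFlow-sum {zero}  X fX = IsFlow-0
  IsFlow-sum {suc k} X fX = IsFlow-+ (fX zero) (IsFlow-sum (X ∘ suc) (fX ∘ suc))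

  IsFlow-∸ : ∀ {X Y} → IsFlow X → IsFlow Y → Y ≤ᶠ X → IsFlow (λ e → X e ∸ Y e)
  IsFlow-∸ {X} {Y} fX fY Y≤X v v≢s v≢t = ℕ.+-cancelʳ-≡ (inflow Y v) _ _ (begin
    inflow Z v + inflow Y v   ≡⟨ split _ ⟩
    inflow X v                ≡⟨ fX v v≢s v≢t ⟩
    outflow X v               ≡⟨ split _ ⟨
    outflow Z v + outflow Y v ≡⟨ cong (outflow Z v +_) (fY v v≢s v≢t) ⟨
    outflow Z v + inflow Y v  ∎)
    where
    open ≡-Reasoning
    Z : EdgeFun
    Z e = X e ∸ Y e
    split : ∀ b → flux b Z + flux b Y ≡ flux b X
    split b = trans (sym (flux-+ b Z Y)) (flux-cong b λ e → ℕ.m∸n+n≡m (Y≤X e))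

  ∣∸∣ : ∀ {X Y} → Y ≤ᶠ X → ∣ X ∣ ≡ ∣ (λ e → X e ∸ Y e) ∣ + ∣ Y ∣
  ∣∸∣ {X} {Y} Y≤X = trans (flux-cong _ λ e → sym (ℕ.m∸n+n≡m (Y≤X e))) (flux-+ _ _ Y)

  -- Walks in subgraphs, and positivity of the value

  Walk : Subgraph → V → V → Set
  Walk H u v = Σ (Star Arc u v) (All H ∘ edges)

  module _ {H : Subgraph} where

    infixr 5 _++ʷ_
    _++ʷ_ : ∀ {u v w} → Walk H u v → Walk H v w → Walk H u w
    (p , hs) ++ʷ (q , ks) = p ◅◅ q , go p hs
      where
      go : ∀ {u} (p : Star Arc u _) → All H (edges p) → All H (edges (p ◅◅ q))
      go ε       []       = ks
      go (_ ◅ p) (h ∷ hs) = h ∷ go p hs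

    edge : ∀ e → H e → Walk H (src e) (tgt e)
    edge e h = (e , refl , refl) ◅ ε , h ∷ []

  ∈-middle : ∀ {u v e} (p : Star Arc u (src e)) {q : Star Arc (tgt e) v} →
             e ∈ edges (p ◅◅ (e , refl , refl) ◅ q)
  ∈-middle ε       = here refl
  ∈-middle (_ ◅ p) = there (∈-middle p)

  mapʷ : ∀ {H K : Subgraph} → H ⊆ K → ∀ {u v} → Walk H u v → Walk K u v
  mapʷ H⊆K (p , hs) = p , All.map H⊆K hs

  -- The part already walked is accumulated in `q` and witnesses that the tail of the next edge is
  -- reachable. For `v = u` and `q` empty, a walk is seen to stay among the vertices reachable from
  -- its start.
  walk-reaches : ∀ {H u v w} → Walk H u v → (r : Walk H v w) →
                 Walk (λ e → H e × Walk H u (src e)) v w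
  walk-reaches q (ε , [])                   = ε , []
  walk-reaches {H} {u} q ((e , refl , refl) ◅ r , h ∷ hs) =
    edge e (h , q) ++ʷ walk-reaches (q ++ʷ edge e h) (r , hs)

  -- Let `R` be the set reachable in the support from the head of an edge `e₀` with nonzero flow. No
  -- support edge leaves `R`, `s` is outside, and `e₀` enters `R` by acyclicity. If `t` were outside
  -- `R`, the flow into `R` would exceed the flow out of it, against conservation. So `t` lies in
  -- `R`, and the cut around the complement of `R` has net outflow `∣ X ∣`, which is positive
  -- because of `e₀`.
  positive-value : ∀ {X} → IsFlow X → ¬ (∀ e → X e ≡ 0) → 0 < ∣ X ∣
  positive-value {X} flow X≢0 = decidable-stable (0 ℕ.<? ∣ X ∣) λ n≯0 →
    X≢0 λ e → decidable-stable (X e ℕ.≟ 0) λ Xe≢0 →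
    ¬¬-dec (Walk (support X) (tgt e)) λ R? → n≯0 (go e Xe≢0 R?)
    where
    go : ∀ e → X e ≢ 0 → (∀ v → Dec (Walk (support X) (tgt e) v)) → 0 < ∣ X ∣
    go e₀ X₀≢0 R? = from-cut (R? t)
      where
      R : V → Bool
      R v = does (R? v)

      R-s : R s ≡ false
      R-s = dec-false (R? s) λ (p , _) → no-walk (s-source e₀) p refl
        where
        no-walk : ∀ {u v} → u ≢ s → Star Arc u v → v ≢ s
        no-walk u≢s ε                      = u≢s
        no-walk u≢s ((e , refl , refl) ◅ p) = no-walk (s-source e) p

      R-src₀ : R (src e₀) ≡ false
      R-src₀ = dec-false (R? _) λ (p , _) →
        acyclic (src e₀) (closed-walk (e₀ , refl , refl) p)

      R-tgt₀ : R (tgt e₀) ≡ true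
      R-tgt₀ = dec-true (R? _) (ε , [])

      R-closed : ∀ e → (if R (src e) then X e else 0) ≤ (if R (tgt e) then X e else 0)
      R-closed e with X e in Xe | R? (src e) | R? (tgt e)
      ... | _     | yes _ | yes _  = ℕ.≤-refl
      ... | _     | no _  | _      = z≤n
      ... | zero  | yes _ | no _   = z≤n
      ... | suc _ | yes w | no ¬w  =
        contradiction (w ++ʷ edge e λ X≡0 → ℕ.1+n≢0 (trans (sym Xe) X≡0)) ¬w

      from-cut : Dec (Walk (support X) (tgt e₀) t) → 0 < ∣ X ∣
      from-cut (no ¬Rt) = contradiction
        (subst (λ b → flux (R ∘ src) X ≡ flux (R ∘ tgt) X + (if b then ∣ X ∣ else 0)) R-s
          (cut flow R (dec-false (R? t) ¬Rt)))
        (ℕ.<⇒≢ (ℕ.<-≤-trans (sum-mono-< R-closed e₀ strict) (ℕ.m≤m+n _ 0)))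
        where
        strict : (if R (src e₀) then X e₀ else 0) < (if R (tgt e₀) then X e₀ else 0)
        strict rewrite R-src₀ | R-tgt₀ = ℕ.n≢0⇒n>0 X₀≢0
      from-cut (yes Rt) = ℕ.+-cancelˡ-< (flux (not ∘ R ∘ tgt) X) 0 ∣ X ∣ (begin-strict
        flux (not ∘ R ∘ tgt) X + 0     ≡⟨ ℕ.+-identityʳ _ ⟩
        flux (not ∘ R ∘ tgt) X         <⟨ sum-mono-< closed e₀ strict₀ ⟩
        flux (not ∘ R ∘ src) X         ≡⟨ cut flow (not ∘ R) (cong not (dec-true (R? t) Rt)) ⟩
        flux (not ∘ R ∘ tgt) X + _     ≡⟨ cong (λ b → flux (not ∘ R ∘ tgt) X +
                                            (if not b then ∣ X ∣ else 0)) R-s ⟩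
        flux (not ∘ R ∘ tgt) X + ∣ X ∣ ∎)
        where
        open ℕ.≤-Reasoning
        closed : ∀ e → (if not (R (tgt e)) then X e else 0)
                       ≤ (if not (R (src e)) then X e else 0)
        closed e with R (src e) | R (tgt e) | R-closed e
        ... | true  | true  | _  = z≤n
        ... | true  | false | X≤0 = X≤0
        ... | false | true  | _  = z≤n
        ... | false | false | _  = ℕ.≤-refl
        strict₀ : (if not (R (tgt e₀)) then X e₀ else 0)
                 < (if not (R (src e₀)) then X e₀ else 0)
        strict₀ rewrite R-src₀ | R-tgt₀ = ℕ.n≢0⇒n>0 X₀≢0

  -- Paths that never re-enter a vertex set

  module _ {S : Pred V 0ℓ} where

    stays-outside : ∀ {u v e} (p : Star Arc u v) →
      All (λ f → ¬ S (src f) → ¬ S (tgt f)) (edges p) → ¬ S u → e ∈ edges p → ¬ S (src e)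
    stays-outside ((_ , refl , refl) ◅ p) (c ∷ cs) ¬Su (here refl) = ¬Su
    stays-outside ((_ , refl , refl) ◅ p) (c ∷ cs) ¬Su (there e∈)  =
      stays-outside p cs (c ¬Su) e∈

    -- After its first exit from `S` the path stays outside, so no later edge starts in `S`.
    leaves-once : ∀ {u v e f} (p : Star Arc u v) →
      All (λ f → ¬ S (src f) → ¬ S (tgt f)) (edges p) →
      e ∈ edges p → S (src e) → ¬ S (tgt e) →
      f ∈ edges p → S (src f) → ¬ S (tgt f) → e ≡ f
    leaves-once (_ ◅ p) (c ∷ cs) (here refl) _ _ (here refl) _ _ = refl
    leaves-once ((_ , refl , refl) ◅ p) (c ∷ cs) (here refl) _ ¬Se (there f∈) Sf _ =
      contradiction Sf (stays-outside p cs ¬Se f∈)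
    leaves-once ((_ , refl , refl) ◅ p) (c ∷ cs) (there e∈) Se _ (here refl) _ ¬Sf =
      contradiction Se (stays-outside p cs ¬Sf e∈)
    leaves-once (_ ◅ p) (c ∷ cs) (there e∈) Se ¬Se (there f∈) Sf ¬Sf =
      leaves-once p cs e∈ Se ¬Se f∈ Sf ¬Sf

  -- A flow of large width inside the support

  -- `Z` is related to `X` by its support only and may exceed it on some edges. The bound `small`
  -- tells by how much a flow must be scaled to dominate `Z`.
  record WideSubflow (X : EdgeFun) (p : ℕ) : Set where
    field
      Z       : EdgeFun
      k       : ℕ
      flow    : IsFlow Z
      inside  : support Z ⊆ support X
      small   : ∀ e → Z e ≤ k
      width   : IsWidth (support Z) k
      value≤  : ∣ X ∣ ≤ k * p

  module _ {X : EdgeFun} (flow : IsFlow X) {p : ℕ}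
           (p-max : ∀ Q q → Carries X Q q → q ≤ p) where

    private
      S T : Pred V 0ℓ
      S = Walk (λ e → p < X e) s
      T v = ¬ S v × Walk (λ e → X e ≢ 0 × ¬ S (tgt e)) v t

      ¬S-t : ¬ S t
      ¬S-t (Q , heavy) = ℕ.<-irrefl refl (p-max Q (suc p) heavy)

      -- The second half of `Admissible` forbids entering `S` from outside, as `leaves-once`
      -- requires.
      Crossing Admissible : Pred E 0ℓ
      Crossing e   = X e ≢ 0 × S (src e) × T (tgt e)
      Admissible e = X e ≢ 0 × (¬ S (src e) → ¬ S (tgt e))

      -- Up to and including `e`, every edge starts in `S`, so admissibility is vacuous there; after
      -- `e`, every edge ends outside `S`.
      route : ∀ e → Crossing e → Walk Admissible s t
      route e (Xe≢0 , Ssrc , _ , out) =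
        mapʷ (λ (p<X , Sf) → ℕ.m<n⇒n≢0 p<X , contradiction Sf)
             (walk-reaches (ε , []) Ssrc)
        ++ʷ edge e (Xe≢0 , contradiction Ssrc)
        ++ʷ mapʷ (λ (Xf≢0 , ¬Sf) → Xf≢0 , λ _ → ¬Sf) out

      ∈-route : ∀ e c → e ∈ edges (proj₁ (route e c))
      ∈-route e (_ , Ssrc , _) = ∈-middle (proj₁ (walk-reaches (ε , []) Ssrc))

    wide-subflow : (∀ v → Dec (S v)) → (∀ v → Dec (T v)) → WideSubflow X p
    wide-subflow S? T? = record
      { Z = Z ; k = k
      ; flow   = IsFlow-sum (⟦_⟧ ∘ R) (path-flow ∘ R)
      ; inside = λ Ze≢0 → proj₁ (Z-admissible Ze≢0)
      ; small  = λ e → ∑≤ λ i → path≤1 (R i) e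
      ; width  = routes , λ j C → injective⇒≤ (covering-injective C)
      ; value≤ = value≤
      }
      where
      c? : ∀ e → Dec (Crossing e)
      c? e = ¬? (X e ℕ.≟ 0) ×-dec S? (src e) ×-dec T? (tgt e)

      crossings : List E
      crossings = filter c? (allFin #E)

      k : ℕ
      k = length crossings

      enum : Fin k → E
      enum = lookup crossings

      crossing : ∀ i → Crossing (enum i)
      crossing i = All.lookup (all-filter c? (allFin #E)) (∈-lookup i)

      R : Fin k → STPath
      R i = proj₁ (route (enum i) (crossing i))

      Z : EdgeFun
      Z e = sum λ i → ⟦ R i ⟧ e

      ∑≤ : ∀ {j} {f : Fin j → ℕ} → (∀ i → f i ≤ 1) → sum f ≤ j
      ∑≤ {zero}  f≤1 = z≤n
      ∑≤ {suc j} f≤1 = ℕ.+-mono-≤ (f≤1 zero) (∑≤ (f≤1 ∘ suc))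

      R-inside : ∀ i {e} → e ∈ edges (R i) → Z e ≢ 0
      R-inside i {e} e∈ = ℕ.m<n⇒n≢0 (ℕ.≤-trans (ℕ.≤-reflexive (sym (path-∈ (R i) e∈)))
                                              (summand≤sum (λ i → ⟦ R i ⟧ e) i))

      Z-enum : ∀ i → Z (enum i) ≢ 0
      Z-enum i = R-inside i (∈-route _ (crossing i))

      Z-admissible : ∀ {e} → Z e ≢ 0 → Admissible e
      Z-admissible {e} Ze≢0 with sum≢0⇒∃ (λ i → ⟦ R i ⟧ e) Ze≢0
      ... | i , ≢0 = All.lookup (proj₂ (route (enum i) (crossing i))) (path≢0 (R i) ≢0)

      routes : PathCover (support Z) k
      routes = record
        { path   = R
        ; inside = λ i → All.tabulate (R-inside i)
        ; covers = λ e Ze≢0 → let i , ≢0 = sum≢0⇒∃ _ Ze≢0 in i , path≢0 (R i) ≢0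
        }

      -- A path within the support of `Z` leaves `S` at most once and so covers at most one crossing
      -- edge. Hence every cover has at least `k` paths.
      covering-injective : ∀ {j} (C : PathCover (support Z) j) → let open PathCover C in
        ∀ {i i′} → proj₁ (covers (enum i) (Z-enum i)) ≡ proj₁ (covers (enum i′) (Z-enum i′)) →
        i ≡ i′
      covering-injective C {i} {i′} eq = unique-lookup-injective
        (filter⁺ c? (allFin⁺ #E))
        (leaves-once {S} (path j)
          (All.map (proj₂ ∘ Z-admissible) (inside j))
          (subst (λ j → enum i ∈ edges (path j)) eq (proj₂ (covers _ (Z-enum i))))
          (proj₁ (proj₂ (crossing i))) (proj₁ (proj₂ (proj₂ (crossing i))))
          (proj₂ (covers _ (Z-enum i′)))
          (proj₁ (proj₂ (crossing i′))) (proj₁ (proj₂ (proj₂ (crossing i′)))))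
        where
        open PathCover C
        j = proj₁ (covers (enum i′) (Z-enum i′))

      -- The cut is taken around the complement of `T`, not around `S`: an edge from `S` to a vertex
      -- outside `S` and `T` need not be a crossing.
      B : V → Bool
      B v = not (does (T? v))

      B-s : B s ≡ true
      B-s = cong not (dec-false (T? s) λ (¬Ss , _) → ¬Ss (ε , []))

      B-t : B t ≡ false
      B-t = cong not (dec-true (T? t) (¬S-t , ε , []))

      crossing-flow : EdgeFun
      crossing-flow e = if does (c? e) then X e else 0

      -- Suppose an edge with nonzero flow goes from outside `T` into `T`. Were its tail outside
      -- `S`, prepending the edge to a walk to `t` would place the tail in `T`. So the tail is in
      -- `S` and the edge is a crossing.
      leaving : ∀ e → (if B (src e) then X e else 0)
                      ≤ (if B (tgt e) then X e else 0) + crossing-flow e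
      leaving e = by-cases (T? (src e)) (T? (tgt e)) (c? e)
        where
        by-cases : (d : Dec (T (src e))) (d′ : Dec (T (tgt e))) (c : Dec (Crossing e)) →
          (if not (does d) then X e else 0)
            ≤ (if not (does d′) then X e else 0) + (if does c then X e else 0)
        by-cases (yes _) _       _       = z≤n
        by-cases (no _)  (no _)  _       = ℕ.m≤m+n _ _
        by-cases (no _)  (yes _) (yes _) = ℕ.≤-refl
        by-cases (no ¬T) (yes Te@(¬Se , r)) (no ¬c) =
          ℕ.≤-reflexive (decidable-stable (X e ℕ.≟ 0) λ Xe≢0 →
            ¬T ((λ Se → ¬c (Xe≢0 , Se , Te)) , edge e (Xe≢0 , ¬Se) ++ʷ r))

      crossing≤p : ∀ e → Crossing e → X e ≤ p
      crossing≤p e (_ , Ssrc , ¬Stgt , _) = ℕ.≮⇒≥ λ p<X → ¬Stgt (Ssrc ++ʷ edge e p<X)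

      value≤ : ∣ X ∣ ≤ k * p
      value≤ = ℕ.+-cancelˡ-≤ (flux (B ∘ tgt) X) _ _ (begin
        flux (B ∘ tgt) X + ∣ X ∣
          ≡⟨ cong (λ b → flux (B ∘ tgt) X + (if b then ∣ X ∣ else 0)) B-s ⟨
        flux (B ∘ tgt) X + (if B s then ∣ X ∣ else 0)
          ≡⟨ cut flow B B-t ⟨
        flux (B ∘ src) X
          ≤⟨ sum-mono-≤ leaving ⟩
        sum (λ e → (if B (tgt e) then X e else 0) + crossing-flow e)
          ≡⟨ Sum.∑-distrib-+ _ crossing-flow ⟩
        flux (B ∘ tgt) X + sum crossing-flow
          ≤⟨ ℕ.+-monoʳ-≤ _ (sum≤*-count c? (λ e → e) X crossing≤p) ⟩
        flux (B ∘ tgt) X + k * p ∎)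
        where open ℕ.≤-Reasoning

  -- Path covers from decompositions

  -- The paths of nonzero weight lie in the support and cover it. An edge with nonzero flow,
  -- extracted from `X≢0` under double negation, yields one such path.
  decomposition-cover : ∀ {X m} → Decomposition X m → ¬ (∀ e → X e ≡ 0) →
                        ¬ ¬ PathCover (support X) m
  decomposition-cover {X} {m} D X≢0 none = X≢0 λ e → decidable-stable (X e ℕ.≟ 0) λ Xe≢0 →
    none (from-nonzero (sum≢0⇒∃ _ (Xe≢0 ∘ trans (decomposes e))))
    where
    open Decomposition D

    on-path : ∀ i → weight i ≢ 0 → ∀ {e} → e ∈ edges (path i) → X e ≢ 0
    on-path i w≢0 {e} e∈ = ℕ.m<n⇒n≢0 (begin-strict
      0                        <⟨ ℕ.n≢0⇒n>0 w≢0 ⟩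
      weight i                 ≡⟨ ℕ.*-identityʳ _ ⟨
      weight i * 1             ≡⟨ cong (weight i *_) (path-∈ (path i) e∈) ⟨
      weight i * ⟦ path i ⟧ e  ≤⟨ summand≤sum _ i ⟩
      _                        ≡⟨ decomposes e ⟨
      X e                      ∎)
      where open ℕ.≤-Reasoning

    weight≢0 : ∀ {i e} → weight i * ⟦ path i ⟧ e ≢ 0 → weight i ≢ 0
    weight≢0 ≢0 w≡0 = ≢0 (cong (_* _) w≡0)

    -- A path of weight 0 may leave the support, so it is replaced by a path of
    -- nonzero weight.
    from-nonzero : ∀ {e} → ∃[ i ] weight i * ⟦ path i ⟧ e ≢ 0 → PathCover (support X) m
    from-nonzero {e₀} (i₀ , ≢0₀) = record
      { path   = λ i → path (index i (weight i ℕ.≟ 0))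
      ; inside = λ i → All.tabulate (on-path _ (index-≢0 i (weight i ℕ.≟ 0)))
      ; covers = λ e Xe≢0 → covered e (sum≢0⇒∃ _ (Xe≢0 ∘ trans (decomposes e)))
      }
      where
      index : ∀ i → Dec (weight i ≡ 0) → Fin m
      index i (yes _) = i₀
      index i (no _)  = i

      index-≢0 : ∀ i d → weight (index i d) ≢ 0
      index-≢0 i (yes _)   = weight≢0 {i₀} {e₀} ≢0₀
      index-≢0 i (no w≢0) = w≢0

      index-self : ∀ i d → weight i ≢ 0 → index i d ≡ i
      index-self i (yes w≡0) w≢0 = contradiction w≡0 w≢0
      index-self i (no _)    _   = refl

      covered : ∀ e → ∃[ i ] weight i * ⟦ path i ⟧ e ≢ 0 →
                ∃[ i ] e ∈ edges (path (index i (weight i ℕ.≟ 0)))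
      covered e (i , ≢0) = i ,
        subst (λ j → e ∈ edges (path j)) (sym (index-self i _ (weight≢0 {i} {e} ≢0)))
          (path≢0 (path i) λ P≡0 → ≢0 (trans (cong (weight i *_) P≡0) (ℕ.*-zeroʳ (weight i))))

  scale-cover : ∀ {X m} c .{{_ : NonZero c}} →
                PathCover (support X) m → PathCover (support (λ e → c * X e)) m
  scale-cover {X} c C = record
    { path   = path
    ; inside = λ i → All.map
        (λ Xe≢0 cX≡0 → Xe≢0 (ℕ.m*n≡0⇒m≡0 _ c (trans (ℕ.*-comm _ c) cX≡0))) (inside i)
    ; covers = λ e cX≢0 → covers e λ Xe≡0 → cX≢0 (trans (cong (c *_) Xe≡0) (ℕ.*-zeroʳ c))
    }
    where open PathCover C

  -- The number of greedy steps

  module _ (stable : WidthStable)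
           {X₀ : EdgeFun} (flow₀ : IsFlow X₀)
           {m : ℕ} (cover₀ : PathCover (support X₀) m) where

    -- Width-stability, applied to `Z` and a multiple of `X₀`, bounds the width `k` of `Z` by `m`.
    value≤m*heaviest : ∀ {X p} → IsFlow X → support X ⊆ support X₀ →
                       (∀ Q q → Carries X Q q → q ≤ p) → ∣ X ∣ ≤ m * p
    value≤m*heaviest {X} {p} flow X⊆X₀ p-max = decidable-stable (∣ X ∣ ℕ.≤? m * p) λ ∣X∣≰ →
      ¬¬-dec _ λ S? → ¬¬-dec _ λ T? → bound (wide-subflow flow p-max S? T?) ∣X∣≰
      where
      bound : WideSubflow X p → ¬ ¬ (∣ X ∣ ≤ m * p)
      -- `WidthStable` compares minima, so the scaled flow must first be given a width. The factor
      -- `suc k` is nonzero even for `k = 0`, so `cover₀` still applies.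
      bound W ∣X∣≰ = ¬¬-minimum _ (scale-cover (suc k) cover₀) λ (b , b-width) →
        ∣X∣≰ (ℕ.≤-trans value≤ (ℕ.*-monoˡ-≤ p (ℕ.≤-trans
          (stable Z Y₀ Z-flow (IsFlow-* (suc k) flow₀) Z≤Y₀ k b width b-width)
          (proj₂ b-width m (scale-cover (suc k) cover₀)))))
        where
        open WideSubflow W renaming (flow to Z-flow)
        -- Z need not be below X₀; scaling makes X₀ large enough without changing
        -- its support.
        Y₀ : EdgeFun
        Y₀ e = suc k * X₀ e
        Z≤Y₀ : Z ≤ᶠ Y₀
        Z≤Y₀ e with Z e ℕ.≟ 0
        ... | yes Ze≡0 = ℕ.≤-trans (ℕ.≤-reflexive Ze≡0) z≤n
        ... | no  Ze≢0 = begin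
          Z e         ≤⟨ small e ⟩
          k           ≤⟨ ℕ.n≤1+n k ⟩
          suc k       ≡⟨ ℕ.*-identityʳ (suc k) ⟨
          suc k * 1   ≤⟨ ℕ.*-monoʳ-≤ (suc k) (ℕ.n≢0⇒n>0 (X⊆X₀ (inside Ze≢0))) ⟩
          Y₀ e        ∎
          where open ℕ.≤-Reasoning

    -- Each pick at least halves `∣ X ∣ ^ m`, which pays for one factor 2 on the left. The factor 2
    -- inside the power pays for the last pick, after which the value is 0.
    greedy-length : 0 < m → s ≢ t → ∀ {X D} → IsFlow X → support X ⊆ support X₀ →
                    0 < ∣ X ∣ → GreedyWeight X D → 2 ^ length D ≤ (2 * ∣ X ∣) ^ m
    greedy-length 0<m s≢t {X} flow X⊆X₀ 0<∣X∣ (stop _) =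
      ℕ.m^n>0 (2 * ∣ X ∣) {{>-nonZero (ℕ.≤-trans 0<∣X∣ (ℕ.m≤m+n _ _))}} m
    greedy-length 0<m s≢t {X} flow X⊆X₀ 0<∣X∣ (pick {P} {p} {D} _ (carries , p-max) rest) =
      step rest
      where
      open ℕ.≤-Reasoning

      pP : EdgeFun
      pP e = p * ⟦ P ⟧ e

      X′ : EdgeFun
      X′ e = X e ∸ pP e

      pP≤X : pP ≤ᶠ X
      pP≤X e with _∈?_ _≟_ e (edges P)
      ... | yes e∈ = ℕ.≤-trans (ℕ.≤-reflexive (ℕ.*-identityʳ p)) (All.lookup carries e∈)
      ... | no  _  = ℕ.≤-trans (ℕ.≤-reflexive (ℕ.*-zeroʳ p)) z≤n

      flow′ : IsFlow X′
      flow′ = IsFlow-∸ flow (IsFlow-* p (path-flow P)) pP≤X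

      X′⊆X₀ : support X′ ⊆ support X₀
      X′⊆X₀ {e} X′≢0 = X⊆X₀ λ X≡0 →
        X′≢0 (trans (cong (_∸ pP e) X≡0) (ℕ.0∸n≡0 (pP e)))

      ∣X∣≡ : ∣ X ∣ ≡ ∣ X′ ∣ + p
      ∣X∣≡ = trans (∣∸∣ pP≤X) (cong (∣ X′ ∣ +_)
        (trans (flux-* _ p ⟦ P ⟧) (trans (cong (p *_) (∣path∣ s≢t P)) (ℕ.*-identityʳ p))))

      halved : 2 * ∣ X′ ∣ ^ m ≤ ∣ X ∣ ^ m
      halved = subst (λ n → 2 * ∣ X′ ∣ ^ m ≤ n ^ m) (sym ∣X∣≡)
        (^-halving ∣ X′ ∣ p m 0<m
          (subst (_≤ m * p) ∣X∣≡ (value≤m*heaviest flow X⊆X₀ p-max)))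

      step : GreedyWeight X′ D → 2 ^ suc (length D) ≤ (2 * ∣ X ∣) ^ m
      -- After the last pick the induction hypothesis is out of reach, since it asks for a positive
      -- value; the bound follows directly from `0 < ∣ X ∣` and `0 < m`.
      step (stop _) = begin
        2                 ≤⟨ ℕ.*-monoʳ-≤ 2 0<∣X∣ ⟩
        2 * ∣ X ∣         ≡⟨ ℕ.^-identityʳ _ ⟨
        (2 * ∣ X ∣) ^ 1   ≤⟨ ℕ.^-monoʳ-≤ (2 * ∣ X ∣)
                              {{>-nonZero (ℕ.≤-trans 0<∣X∣ (ℕ.m≤m+n _ _))}} 0<m ⟩
        (2 * ∣ X ∣) ^ m   ∎
      step rest@(pick X′≢0 _ _) = begin
        2 * 2 ^ length D           ≤⟨ ℕ.*-monoʳ-≤ 2 (greedy-length 0<m s≢t flow′ X′⊆X₀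
                                       (positive-value flow′ X′≢0) rest) ⟩
        2 * (2 * ∣ X′ ∣) ^ m       ≡⟨ cong (2 *_) (^-distribʳ-* m 2 ∣ X′ ∣) ⟩
        2 * (2 ^ m * ∣ X′ ∣ ^ m)   ≡⟨ solve 2 (λ a b → con 2 :* (a :* b) := a :* (con 2 :* b))
                                        refl (2 ^ m) (∣ X′ ∣ ^ m) ⟩
        2 ^ m * (2 * ∣ X′ ∣ ^ m)   ≤⟨ ℕ.*-monoʳ-≤ (2 ^ m) halved ⟩
        2 ^ m * ∣ X ∣ ^ m          ≡⟨ ^-distribʳ-* m 2 ∣ X ∣ ⟨
        (2 * ∣ X ∣) ^ m            ∎
        where open +-*-Solver

theorem2 : ∃[ C ] (0 < C × ((G : STDAG) → let open Flows G in
    WidthStable →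
    (X : EdgeFun) → IsFlow X → 2 ≤ ∣ X ∣ →
    (m : ℕ) → IsMfd X m →
    (D : List (STPath × ℕ)) → GreedyWeight X D →
    length D ≤ C * m ·log₂ ∣ X ∣))
-- The constant 2 absorbs the factor in `(2 * n) ^ m`, because `2 ≤ n` gives `2 * n ≤ n ^ 2`.
theorem2 = 2 , s≤s z≤n , λ G stable X flow 2≤∣X∣ m (decomposition , _) D greedy →
  let open STDAG G
      open Flows G

      X≢0 : ¬ (∀ e → X e ≡ 0)
      X≢0 X≡0 = ℕ.m<n⇒n≢0 2≤∣X∣ (trans (flux-cong G _ X≡0) (flux-0 G _))

      s≢t : s ≢ t
      s≢t = value≢0⇒s≢t G X (ℕ.m<n⇒n≢0 2≤∣X∣)

      0<m : 0 < m
      -- A decomposition into no paths is an empty sum and would make `X` vanish.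
      0<m = ℕ.n≢0⇒n>0 λ { refl → X≢0 (Decomposition.decomposes decomposition) }

      n = ∣ X ∣
      open ℕ.≤-Reasoning
  in decidable-stable (2 ^ length D ℕ.≤? n ^ (2 * m)) λ ≰ →
     decomposition-cover G decomposition X≢0 λ cover → ≰ (begin
       2 ^ length D   ≤⟨ greedy-length G stable flow cover 0<m s≢t flow (λ ≢0 → ≢0)
                          (ℕ.<-trans (s≤s z≤n) 2≤∣X∣) greedy ⟩
       (2 * n) ^ m    ≤⟨ ℕ.^-monoˡ-≤ m (ℕ.*-monoˡ-≤ n 2≤∣X∣) ⟩
       (n * n) ^ m    ≡⟨ cong (λ x → (n * x) ^ m) (ℕ.*-identityʳ n) ⟨
       (n ^ 2) ^ m    ≡⟨ ℕ.^-*-assoc n 2 m ⟩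
       n ^ (2 * m)    ∎)
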